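{- Let $G$ be a tree with $n$ vertices. Then $\mathrm{irr}_t(G) \leq (n-1)(n-2)$. Moreover, equality holds if and only if $G$ is a star graph.
   Context: All graphs are finite and undirected, without loops or multiple edges. For a graph $G$ and $u \in V(G)$, $d_G(u)$ denotes the degree of $u$. The total irregularity of $G$ is $\mathrm{irr}_t(G) = \frac{1}{2}\sum_{u,v \in V(G)} |d_G(u) - d_G(v)|$, where the sum is over all ordered pairs $(u,v)$ of vertices, so that each unordered pair of distinct vertices contributes $|d_G(u)-d_G(v)|$ exactly once. The star graph on $n$ vertices is $K_{1,n-1}$, i.e. the tree in which one vertex is adjacent to all the others. -}

module Defs where

open import Data.Bool.Base using (Bool; true; false)
import Data.Bool.Properties as Bool
open import Data.Fin.Base using (Fin; splitAt)
open import Data.Fin.Permutation using (Permutation; _⟨$⟩ʳ_)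
open import Data.Fin.Subset using (Subset; ∣_∣)
open import Data.Integer.Base using (+_)
open import Data.List.Base using (List; _∷_; _∷ʳ_; length)
open import Data.List.Relation.Unary.Linked using (Linked)
open import Data.List.Relation.Unary.Unique.Propositional using (Unique)
open import Data.Nat.Base using (ℕ; _+_; _∸_; _≤_; ∣_-_∣; NonZero)
open import Data.Nat.Properties using (+-0-commutativeMonoid)
open import Algebra.Properties.CommutativeMonoid.Sum +-0-commutativeMonoid using (sum-syntax)
open import Data.Product.Base using (Σ-syntax)
open import Data.Rational.Base as ℚ using (ℚ; ½)
open import Data.Sum.Base using ([_,_]′)
open import Data.Vec.Base using (tabulate)
open import Function.Base using (const)
open import Function.Bundles using (_⇔_)
open import Level using (0ℓ)
open import Relation.Binary.Construct.Closure.ReflexiveTransitive using (Star)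
open import Relation.Binary.Core using (Rel)
open import Relation.Binary.Definitions using (Decidable; Irreflexive; Symmetric)
open import Relation.Binary.PropositionalEquality using (_≡_; _≢_; refl; ≢-sym)
open import Relation.Nullary using (¬_; does)
open import Relation.Nullary.Decidable using (¬?)

-- Vertices are labelled by Fin n.  Decidability of adjacency, automatic
-- classically, is what makes degrees computable.
record Graph (n : ℕ) : Set₁ where
  infix 4 _~_ _~?_
  field
    _~_      : Rel (Fin n) 0ℓ
    _~?_     : Decidable _~_
    ~-sym    : Symmetric _~_
    ~-irrefl : Irreflexive _≡_ _~_

  neighbours : Fin n → Subset n
  neighbours u = tabulate λ v → does (u ~? v)

  degree : Fin n → ℕ
  degree u = ∣ neighbours u ∣

  -- The cycle v, v₁, …, vₖ, v is given by its start v and the list v₁, …, vₖ.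
  record IsCycle (v : Fin n) (vs : List (Fin n)) : Set where
    field
      length≥3 : 3 ≤ length (v ∷ vs)
      distinct : Unique (v ∷ vs)
      closed   : Linked _~_ (v ∷ vs ∷ʳ v)

open Graph using (degree; IsCycle)

-- The graph without vertices does not count as connected.
record IsConnected {n : ℕ} (G : Graph n) : Set where
  open Graph G using (_~_)
  field
    nonEmpty : NonZero n
    walk     : ∀ u v → Star _~_ u v

IsAcyclic : ∀ {n} → Graph n → Set
IsAcyclic G = ∀ v vs → ¬ IsCycle G v vs

record IsTree {n : ℕ} (G : Graph n) : Set where
  field
    connected : IsConnected G
    acyclic   : IsAcyclic G

Isomorphic : ∀ {m n} → Graph m → Graph n → Set
Isomorphic {m} {n} G H =
  Σ[ π ∈ Permutation m n ] (∀ u v → (u G.~ v) ⇔ ((π ⟨$⟩ʳ u) H.~ (π ⟨$⟩ʳ v)))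
  where
  module G = Graph G
  module H = Graph H

-- The complete bipartite graph: the first a vertices form one part, the
-- last b the other.
K : (a b : ℕ) → Graph (a + b)
K a b = record
  { _~_      = λ u v → part u ≢ part v
  ; _~?_     = λ u v → ¬? (part u Bool.≟ part v)
  ; ~-sym    = ≢-sym
  ; ~-irrefl = λ { refl u≢u → u≢u refl }
  }
  where
  part : Fin (a + b) → Bool
  part u = [ const true , const false ]′ (splitAt a u)

-- For n = 0 the truncated subtraction gives K 1 0, which has one vertex, so
-- the graph without vertices is not a star.
IsStar : ∀ {n} → Graph n → Set
IsStar {n} G = Isomorphic G (K 1 (n ∸ 1))

irrₜ : ∀ {n} → Graph n → ℚ
irrₜ {n} G = ½ ℚ.* (+ (∑[ u < n ] ∑[ v < n ] ∣ degree G u - degree G v ∣) ℚ./ 1)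

{-# OPTIONS --safe #-}

-- Write d(u) = 1 + e(u); in a tree on n ≥ 2 vertices all degrees are positive,
-- so e(u) ≥ 0.  An acyclic graph has a vertex of degree at most 1, and deleting
-- it lowers Σ d by at most 2, so Σ d ≤ 2(n − 1), that is Σ e ≤ n − 2.  Since
-- |d(u) − d(v)| ≤ e(u) + e(v), summing over the ordered pairs u ≠ v gives at
-- most 2(n − 1) Σ e ≤ 2(n − 1)(n − 2).  Equality forces e(u) = 0 or e(v) = 0 for
-- all u ≠ v, so that at most one vertex is not a leaf; by connectedness that
-- vertex is adjacent to all the others.

module Submission where

open import Defs
open import Data.Bool.Base using (Bool; true; false; if_then_else_)
open import Data.Fin.Base using (Fin; zero; suc; punchIn; punchOut)
open import Data.Fin.Permutation as Perm using (_⟨$⟩ʳ_)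
open import Data.Fin.Properties
  using (_≟_; any?; all?; ¬∀⟶∃¬; injective⇒≤; punchIn-injective; punchIn-punchOut; punchInᵢ≢i)
open import Data.Fin.Subset using (∣_∣)
open import Data.Integer.Base as ℤ using (+_)
import Data.Integer.Properties as ℤ
open import Data.List.Base using (List; []; _∷_; _++_; _∷ʳ_; length; lookup; map)
open import Data.List.Membership.Propositional using (_∈_)
open import Data.List.Membership.Propositional.Properties using (∈-lookup; ∈-∃++)
open import Data.List.Properties using (length-map; map-++)
open import Data.List.Relation.Unary.All as All using (All; []; _∷_)
import Data.List.Relation.Unary.All.Properties as All
open import Data.List.Relation.Unary.AllPairs using ([]; _∷_)
open import Data.List.Relation.Unary.Linked using (Linked; [-]; _∷_)
import Data.List.Relation.Unary.Linked.Properties as Linked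
open import Data.List.Relation.Unary.Unique.Propositional using (Unique)
import Data.List.Relation.Unary.Unique.Propositional.Properties as Unique
open import Data.Nat.Base
  using (ℕ; zero; suc; pred; _+_; _*_; _∸_; ∣_-_∣; z≤n; s≤s; >-nonZero; ≢-nonZero⁻¹)
  renaming (_≤_ to _≤ℕ_; _<_ to _<ℕ_)
open import Data.Nat.Properties as ℕ using (+-0-commutativeMonoid)
open import Data.Nat.Tactic.RingSolver using (solve-∀)
open import Algebra.Properties.CommutativeMonoid.Sum +-0-commutativeMonoid
open import Algebra.Properties.Semiring.Sum ℕ.+-*-semiring using (*-distribˡ-sum)
open import Data.Product.Base using (_×_; _,_; ∃; ∃₂; proj₁; proj₂)
open import Data.Rational.Base using (_/_; _≤_; ½; toℚᵘ)
import Data.Rational.Base as ℚ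
import Data.Rational.Properties as ℚ
open import Data.Rational.Unnormalised.Base as ℚᵘ using (mkℚᵘ; *≤*; *≡*)
import Data.Rational.Unnormalised.Properties as ℚᵘ
open import Data.Sum.Base using (_⊎_; inj₁; inj₂; [_,_]′)
open import Data.Vec.Base using (tabulate)
open import Function.Base using (_∘_)
open import Function.Bundles using (_⇔_; mk⇔; Equivalence)
open import Function.Definitions using (Injective)
open import Level using (0ℓ)
open import Relation.Binary.Construct.Closure.ReflexiveTransitive using (Star; ε; _◅_)
open import Relation.Binary.Core using (Rel)
open import Relation.Binary.PropositionalEquality
open import Relation.Nullary using (¬_; yes; no; does; contradiction)
open import Relation.Nullary.Decidable using (_→-dec_; decidable-stable; does-⇔; dec-true; dec-false)

-- Finite sums

sum-mono : ∀ {n} {f g : Fin n → ℕ} → (∀ i → f i ≤ℕ g i) → sum f ≤ℕ sum g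
sum-mono {zero}  f≤g = z≤n
sum-mono {suc n} f≤g = ℕ.+-mono-≤ (f≤g zero) (sum-mono (f≤g ∘ suc))

-- A strict gain of `g` over `f` at one index could not be made up elsewhere: bounding the other
-- terms by `f≤g` and cancelling them leaves the reverse inequality at that index.
sum-mono-tight : ∀ {n} {f g : Fin n → ℕ} → (∀ i → f i ≤ℕ g i) →
                 sum g ≤ℕ sum f → ∀ i → g i ≤ℕ f i
sum-mono-tight {suc n} {f} {g} f≤g Σg≤Σf zero =
  ℕ.+-cancelʳ-≤ (sum (g ∘ suc)) _ _
    (ℕ.≤-trans Σg≤Σf (ℕ.+-monoʳ-≤ (f zero) (sum-mono (f≤g ∘ suc))))
sum-mono-tight {suc n} {f} {g} f≤g Σg≤Σf (suc i) =
  sum-mono-tight (f≤g ∘ suc)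
    (ℕ.+-cancelˡ-≤ (g zero) _ _
      (ℕ.≤-trans Σg≤Σf (ℕ.+-monoˡ-≤ (sum (f ∘ suc)) (f≤g zero)))) i

sum-const : ∀ n c → ∑[ _ < n ] c ≡ n * c
sum-const zero    c = refl
sum-const (suc n) c = cong (_+_ c) (sum-const n c)

sum-zero : ∀ {n} {f : Fin n → ℕ} → (∀ i → f i ≡ 0) → sum f ≡ 0
sum-zero {n} f≡0 = trans (sum-cong-≗ f≡0) (sum-replicate-zero n)

term≤sum : ∀ {n} (f : Fin n → ℕ) i → f i ≤ℕ sum f
term≤sum {suc n} f i = ℕ.≤-trans (ℕ.m≤m+n _ _) (ℕ.≤-reflexive (sym (sum-remove f)))

two-terms≤sum : ∀ {n} (f : Fin n → ℕ) {i j} → i ≢ j → f i + f j ≤ℕ sum f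
two-terms≤sum {suc n} f {i} {j} i≢j = begin
  f i + f j                               ≡⟨ cong (λ k → f i + f k) (punchIn-punchOut i≢j) ⟨
  f i + f (punchIn i (punchOut i≢j))      ≤⟨ ℕ.+-monoʳ-≤ (f i) (term≤sum (f ∘ punchIn i) (punchOut i≢j)) ⟩
  f i + sum (f ∘ punchIn i)               ≡⟨ sum-remove f ⟨
  sum f                                   ∎
  where open ℕ.≤-Reasoning

sum-single : ∀ {n} (f : Fin n → ℕ) w → (∀ v → v ≢ w → f v ≡ 0) → sum f ≡ f w
sum-single {suc n} f w f≡0 = begin
  sum f                        ≡⟨ sum-remove f ⟩
  f w + sum (f ∘ punchIn w)    ≡⟨ cong (_+_ (f w)) (sum-zero λ v → f≡0 _ (punchInᵢ≢i w v)) ⟩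
  f w + 0                      ≡⟨ ℕ.+-identityʳ (f w) ⟩
  f w                          ∎
  where open ≡-Reasoning

-- The pairs of distinct vertices are parametrised as `(u , punchIn u v)`, so sums over them carry
-- no side condition.
∑∑-off-diagonal : ∀ {m} (f : Fin (suc m) → Fin (suc m) → ℕ) →
  ∑[ u < suc m ] ∑[ v < suc m ] f u v ≡
  ∑[ u < suc m ] f u u + ∑[ u < suc m ] ∑[ v < m ] f u (punchIn u v)
∑∑-off-diagonal f =
  trans (sum-cong-≗ (λ u → sum-remove {i = u} (f u)))
        (∑-distrib-+ (λ u → f u u) (λ u → ∑[ v < _ ] f u (punchIn u v)))

-- Irregularity of a sequence of naturals

spread : ∀ {n} → (Fin n → ℕ) → ℕ
spread {n} f = ∑[ u < n ] ∑[ v < n ] ∣ f u - f v ∣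

spread-cong : ∀ {n} {f g : Fin n → ℕ} → f ≗ g → spread f ≡ spread g
spread-cong f≗g = sum-cong-≗ λ u → sum-cong-≗ λ v → cong₂ ∣_-_∣ (f≗g u) (f≗g v)

∣m-n∣≤m+n : ∀ m n → ∣ m - n ∣ ≤ℕ m + n
∣m-n∣≤m+n m n = ℕ.≤-trans (ℕ.∣m-n∣≤m⊔n m n) (ℕ.m⊔n≤m+n m n)

-- For two successors the difference equals that of the predecessors, hence is at most their sum,
-- which is two less than required.
m+n≤∣m-n∣⇒≡0 : ∀ m n → m + n ≤ℕ ∣ m - n ∣ → m ≡ 0 ⊎ n ≡ 0
m+n≤∣m-n∣⇒≡0 zero    n       _ = inj₁ refl
m+n≤∣m-n∣⇒≡0 (suc m) zero    _ = inj₂ refl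
m+n≤∣m-n∣⇒≡0 (suc m) (suc n) p =
  contradiction (ℕ.≤-trans (ℕ.≤-trans p (∣m-n∣≤m+n m n)) (ℕ.+-monoʳ-≤ m (ℕ.n≤1+n n))) ℕ.1+n≰n

module _ {m} (e : Fin (suc m) → ℕ) where

  private
    absDiff plus : Fin (suc m) → Fin m → ℕ
    absDiff u v = ∣ e u - e (punchIn u v) ∣
    plus    u v = e u + e (punchIn u v)

    absDiff≤plus : ∀ u v → absDiff u v ≤ℕ plus u v
    absDiff≤plus u v = ∣m-n∣≤m+n (e u) (e (punchIn u v))

    rows-mono : ∀ u → sum (absDiff u) ≤ℕ sum (plus u)
    rows-mono u = sum-mono (absDiff≤plus u)

    spread≡ : spread e ≡ ∑[ u < suc m ] ∑[ v < m ] absDiff u v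
    spread≡ = trans (∑∑-off-diagonal (λ u v → ∣ e u - e v ∣))
                    (cong (_+ ∑[ u < suc m ] ∑[ v < m ] absDiff u v) (sum-zero (λ u → ℕ.∣n-n∣≡0 (e u))))

    -- The full square sums to `2 * suc m * sum e` and its diagonal to `2 * sum e`. The diagonal is
    -- added to both sides and cancelled, which avoids subtraction.
    ∑∑plus : ∑[ u < suc m ] ∑[ v < m ] plus u v ≡ m * sum e * 2
    ∑∑plus = ℕ.+-cancelˡ-≡ (sum e + sum e) _ _ (begin
      (sum e + sum e) + ∑[ u < suc m ] ∑[ v < m ] plus u v
        ≡⟨ cong (_+ ∑[ u < suc m ] ∑[ v < m ] plus u v) (∑-distrib-+ e e) ⟨
      ∑[ u < suc m ] (e u + e u) + ∑[ u < suc m ] ∑[ v < m ] plus u v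
        ≡⟨ ∑∑-off-diagonal (λ u v → e u + e v) ⟨
      ∑[ u < suc m ] ∑[ v < suc m ] (e u + e v)
        ≡⟨ sum-cong-≗ (λ u → trans (∑-distrib-+ (λ _ → e u) e)
                                   (cong (_+ sum e) (sum-const (suc m) (e u)))) ⟩
      ∑[ u < suc m ] (suc m * e u + sum e)
        ≡⟨ ∑-distrib-+ (λ u → suc m * e u) (λ _ → sum e) ⟩
      ∑[ u < suc m ] (suc m * e u) + ∑[ _ < suc m ] sum e
        ≡⟨ cong₂ _+_ (sym (*-distribˡ-sum (suc m) e)) (sum-const (suc m) (sum e)) ⟩
      suc m * sum e + suc m * sum e
        ≡⟨ arith m (sum e) ⟩
      (sum e + sum e) + m * sum e * 2
        ∎)
      where
      open ≡-Reasoning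
      arith : ∀ m s → suc m * s + suc m * s ≡ (s + s) + m * s * 2
      arith = solve-∀

  spread-≤ : spread e ≤ℕ m * sum e * 2
  spread-≤ = subst₂ _≤ℕ_ (sym spread≡) ∑∑plus (sum-mono rows-mono)

  -- Tightness of the double sum descends to every row and then to every term, so `e u + e v` is
  -- attained by the difference.
  spread-≥⇒≡0 : m * sum e * 2 ≤ℕ spread e → ∀ {u v} → u ≢ v → e u ≡ 0 ⊎ e v ≡ 0
  spread-≥⇒≡0 tight {u} {v} u≢v = m+n≤∣m-n∣⇒≡0 (e u) (e v)
    (subst (λ w → e u + e w ≤ℕ ∣ e u - e w ∣) (punchIn-punchOut u≢v)
      (sum-mono-tight (absDiff≤plus u) row-tight (punchOut u≢v)))
    where
    row-tight : sum (plus u) ≤ℕ sum (absDiff u)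
    row-tight = sum-mono-tight rows-mono (subst₂ _≤ℕ_ (sym ∑∑plus) spread≡ tight) u

-- Degrees

∣tabulate∣≡sum : ∀ {n} (f : Fin n → Bool) →
                 ∣ tabulate f ∣ ≡ ∑[ i < n ] (if f i then 1 else 0)
∣tabulate∣≡sum {zero}  f = refl
∣tabulate∣≡sum {suc n} f with f zero
... | true  = cong suc (∣tabulate∣≡sum (f ∘ suc))
... | false = ∣tabulate∣≡sum (f ∘ suc)

module Adjacency {n} (G : Graph n) where
  open Graph G public

  -- The adjacency matrix with numerical entries, so that degrees become row sums.
  adj : Fin n → Fin n → ℕ
  adj u v = if does (u ~? v) then 1 else 0

  degree≡sum : ∀ u → degree u ≡ ∑[ v < n ] adj u v
  degree≡sum u = ∣tabulate∣≡sum (λ v → does (u ~? v))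

  adj≡1 : ∀ {u v} → u ~ v → adj u v ≡ 1
  adj≡1 {u} {v} u~v = cong (if_then 1 else 0) (dec-true (u ~? v) u~v)

  adj≡0 : ∀ {u v} → ¬ (u ~ v) → adj u v ≡ 0
  adj≡0 {u} {v} u≁v = cong (if_then 1 else 0) (dec-false (u ~? v) u≁v)

  adj≤1 : ∀ u v → adj u v ≤ℕ 1
  adj≤1 u v with does (u ~? v)
  ... | true  = ℕ.≤-refl
  ... | false = z≤n

  adj-sym : ∀ u v → adj u v ≡ adj v u
  adj-sym u v = cong (if_then 1 else 0) (does-⇔ (mk⇔ ~-sym ~-sym) (u ~? v) (v ~? u))

  degree>0 : ∀ {u v} → u ~ v → 0 <ℕ degree u
  degree>0 {u} {v} u~v = subst₂ _≤ℕ_ (adj≡1 u~v) (sym (degree≡sum u)) (term≤sum (adj u) v)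

  walk⇒degree>0 : ∀ {u v} → Star _~_ u v → u ≢ v → 0 <ℕ degree u
  walk⇒degree>0 ε         u≢u = contradiction refl u≢u
  walk⇒degree>0 (u~w ◅ _) _   = degree>0 u~w

  degree≤1⇒unique-neighbour : ∀ {u v w} → degree u ≤ℕ 1 → u ~ v → u ~ w → v ≡ w
  degree≤1⇒unique-neighbour {u} {v} {w} d≤1 u~v u~w = decidable-stable (v ≟ w) λ v≢w →
    ℕ.1+n≰n (begin
      2                     ≡⟨ cong₂ _+_ (adj≡1 u~v) (adj≡1 u~w) ⟨
      adj u v + adj u w     ≤⟨ two-terms≤sum (adj u) v≢w ⟩
      sum (adj u)           ≡⟨ degree≡sum u ⟨
      degree u              ≤⟨ d≤1 ⟩
      1                     ∎)
    where open ℕ.≤-Reasoning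

  -- Only the entry of the row at `w` can be nonzero. An isolated `u` is included, with any `w`.
  unique-neighbour⇒degree≤1 : ∀ {u w} → (∀ v → u ~ v → v ≡ w) → degree u ≤ℕ 1
  unique-neighbour⇒degree≤1 {u} {w} unique = begin
    degree u       ≡⟨ degree≡sum u ⟩
    sum (adj u)    ≡⟨ sum-single (adj u) w (λ v v≢w → adj≡0 (v≢w ∘ unique v)) ⟩
    adj u w        ≤⟨ adj≤1 u w ⟩
    1              ∎
    where open ℕ.≤-Reasoning

-- Acyclic graphs have at most n − 1 edges

module _ {A : Set} where

  unique-prefix : ∀ {x : A} ys {zs} → Unique (ys ++ x ∷ zs) → Unique (x ∷ ys)
  unique-prefix []       _             = [] ∷ []
  unique-prefix (y ∷ ys) (y≢ ∷ unique) with unique-prefix ys unique | All.++⁻ ys y≢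
  ... | x≢ ∷ uys | y≢ys , y≢x ∷ _ = (≢-sym y≢x ∷ x≢) ∷ y≢ys ∷ uys

  linked-prefix : ∀ {R : Rel A 0ℓ} {x} ys {zs} → Linked R (ys ++ x ∷ zs) → Linked R (ys ∷ʳ x)
  linked-prefix []           _       = [-]
  linked-prefix (y ∷ [])     (r ∷ _) = r ∷ [-]
  linked-prefix (y ∷ z ∷ ys) (r ∷ l) = r ∷ linked-prefix (z ∷ ys) l

  lookup-injective : ∀ {xs : List A} → Unique xs → Injective _≡_ _≡_ (lookup xs)
  lookup-injective {_ ∷ xs} (x≢ ∷ _) {zero}  {zero}  _  = refl
  lookup-injective {_ ∷ xs} (x≢ ∷ _) {zero}  {suc j} eq = contradiction eq (All.lookup x≢ (∈-lookup j))
  lookup-injective {_ ∷ xs} (x≢ ∷ _) {suc i} {zero}  eq = contradiction (sym eq) (All.lookup x≢ (∈-lookup i))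
  lookup-injective {_ ∷ xs} (_ ∷ u)  {suc i} {suc j} eq = cong suc (lookup-injective u eq)

-- Pigeonhole: `lookup` embeds the positions of the list into `Fin n`.
unique⇒length≤n : ∀ {n} {xs : List (Fin n)} → Unique xs → length xs ≤ℕ n
unique⇒length≤n unique = injective⇒≤ (lookup-injective unique)

-- For injective `f` this is the subgraph induced on the image of `f`, up to labelling; with
-- `f = punchIn x` it is the graph with `x` deleted.
pullback : ∀ {m n} → (Fin m → Fin n) → Graph n → Graph m
pullback f G = record
  { _~_      = λ u v → f u ~ f v
  ; _~?_     = λ u v → f u ~? f v
  ; ~-sym    = ~-sym
  ; ~-irrefl = λ { refl → ~-irrefl refl }
  }
  where open Graph G

pullback-acyclic : ∀ {m n} {f : Fin m → Fin n} {G : Graph n} →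
                   Injective _≡_ _≡_ f → IsAcyclic G → IsAcyclic (pullback f G)
pullback-acyclic {f = f} {G} f-inj acyclic v vs cycle = acyclic (f v) (map f vs) record
  { length≥3 = subst (λ k → 3 ≤ℕ suc k) (sym (length-map f vs)) length≥3
  ; distinct = Unique.map⁺ f-inj distinct
  ; closed   = subst (Linked _~_) (cong (f v ∷_) (map-++ f vs (v ∷ []))) (Linked.map⁺ closed)
  }
  where
  open Graph G using (_~_)
  open Graph.IsCycle cycle

module _ {n} (G : Graph n) (acyclic : IsAcyclic G) where
  open Adjacency G

  -- An occurrence of `x` in `ws` would close a cycle: from `x` to `v`, then along the path up to
  -- that occurrence. It contains `x`, `v` and `w`, hence has at least three vertices.
  no-chord : ∀ {x v w ws} → Unique (v ∷ w ∷ ws) → Linked _~_ (v ∷ w ∷ ws) →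
             x ~ v → ¬ (x ∈ ws)
  no-chord {x} {v} {w} unique linked x~v x∈ws with ∈-∃++ x∈ws
  ... | ys , zs , refl = acyclic x (v ∷ w ∷ ys) record
    { length≥3 = s≤s (s≤s (s≤s z≤n))
    ; distinct = unique-prefix (v ∷ w ∷ ys) unique
    ; closed   = x~v ∷ linked-prefix (v ∷ w ∷ ys) linked
    }

  -- A path whose end always has a neighbour besides the previous vertex can be
  -- prolonged without end, as it never returns to itself.
  long-path : Fin n → (∀ u w → ∃ λ v → u ~ v × v ≢ w) →
              ∀ k → ∃₂ λ v vs → Unique (v ∷ vs) × Linked _~_ (v ∷ vs) × length vs ≡ k
  long-path v₀ next zero = v₀ , [] , [] ∷ [] , [-] , refl
  long-path v₀ next (suc k) with long-path v₀ next k
  -- A one-vertex path has no previous vertex to avoid; `v` itself fills the argument, and `x≢v` is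
  -- just what distinctness asks for.
  ... | v , [] , unique , linked , len with next v v
  ...   | x , v~x , x≢v =
    x , v ∷ [] , (x≢v ∷ []) ∷ unique , ~-sym v~x ∷ linked , cong suc len
  long-path v₀ next (suc k) | v , w ∷ ws , unique , linked , len with next v w
  ...   | x , v~x , x≢w =
    x , v ∷ w ∷ ws , (≢-sym (λ v≡x → ~-irrefl v≡x v~x) ∷ x≢w ∷ x≢ws) ∷ unique
      , ~-sym v~x ∷ linked , cong suc len
    where
    x≢ws : All (x ≢_) ws
    x≢ws = All.¬Any⇒All¬ ws (no-chord unique linked (~-sym v~x))

  -- If no vertex has all its neighbours equal to a single `w`, then every vertex has a neighbour
  -- avoiding any given one, and `long-path` yields a path with too many vertices.
  exists-leaf : Fin n → ∃ λ u → degree u ≤ℕ 1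
  exists-leaf v₀ with any? (λ u → any? λ w → all? λ v → (u ~? v) →-dec (v ≟ w))
  ... | yes (u , w , unique) = u , unique-neighbour⇒degree≤1 unique
  ... | no ¬leaf = contradiction (unique⇒length≤n unique) (ℕ.<⇒≱ (s≤s (ℕ.≤-reflexive (sym len))))
    where
    next : ∀ u w → ∃ λ v → u ~ v × v ≢ w
    next u w with ¬∀⟶∃¬ n _ (λ v → (u ~? v) →-dec (v ≟ w)) (λ unique → ¬leaf (u , w , unique))
    ... | v , ¬imp = v , decidable-stable (u ~? v) (λ u≁v → ¬imp (λ u~v → contradiction u~v u≁v))
                       , λ v≡w → ¬imp (λ _ → v≡w)
    -- Here `n` counts the vertices after the first, so the path has one vertex more than the graph.
    path = long-path v₀ next n
    unique = proj₁ (proj₂ (proj₂ path))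
    len = proj₂ (proj₂ (proj₂ (proj₂ path)))

-- Each edge at `x` is counted once in the degree of `x` and once in that of its other end; all
-- other edges survive the deletion.
∑degree-delete : ∀ {n} (G : Graph (suc n)) x →
  sum (Graph.degree G) ≡ Graph.degree G x * 2 + sum (Graph.degree (pullback (punchIn x) G))
∑degree-delete {n} G x = begin
  sum degree
    ≡⟨ sum-remove degree ⟩
  degree x + ∑[ u < n ] degree (punchIn x u)
    ≡⟨ cong (_+_ (degree x)) (sum-cong-≗ degree-split) ⟩
  degree x + ∑[ u < n ] (adj x (punchIn x u) + G-x.degree u)
    ≡⟨ cong (_+_ (degree x)) (∑-distrib-+ (adj x ∘ punchIn x) G-x.degree) ⟩
  degree x + (∑[ u < n ] adj x (punchIn x u) + sum G-x.degree)
    ≡⟨ cong (λ k → degree x + (k + sum G-x.degree)) degree-x ⟨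
  degree x + (degree x + sum G-x.degree)
    ≡⟨ arith (degree x) (sum G-x.degree) ⟩
  degree x * 2 + sum G-x.degree
    ∎
  where
  open ≡-Reasoning
  open Adjacency G
  module G-x = Adjacency (pullback (punchIn x) G)
  arith : ∀ a b → a + (a + b) ≡ a * 2 + b
  arith = solve-∀
  degree-x : degree x ≡ ∑[ u < n ] adj x (punchIn x u)
  degree-x = trans (degree≡sum x) (trans (sum-remove (adj x))
    (cong (_+ ∑[ u < n ] adj x (punchIn x u)) (adj≡0 (~-irrefl refl))))
  degree-split : ∀ u → degree (punchIn x u) ≡ adj x (punchIn x u) + G-x.degree u
  degree-split u = trans (degree≡sum (punchIn x u)) (trans (sum-remove {i = x} (adj (punchIn x u)))
    (cong₂ _+_ (adj-sym (punchIn x u) x) (sym (G-x.degree≡sum u))))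

-- The induction runs over forests, a class closed under deleting a vertex by `pullback-acyclic`.
acyclic⇒∑degree≤ : ∀ {m} (G : Graph (suc m)) → IsAcyclic G → sum (Graph.degree G) ≤ℕ m * 2
acyclic⇒∑degree≤ {zero} G acyclic = ℕ.≤-reflexive (sum-zero {f = degree} λ { zero →
  trans (degree≡sum zero) (sum-zero {f = adj zero} λ { zero → adj≡0 (~-irrefl refl) }) })
  where open Adjacency G
acyclic⇒∑degree≤ {suc m} G acyclic with exists-leaf G acyclic zero
... | x , d≤1 = begin
  sum (Graph.degree G)                   ≡⟨ ∑degree-delete G x ⟩
  Graph.degree G x * 2 + sum (Graph.degree G-x)
    ≤⟨ ℕ.+-mono-≤ (ℕ.*-monoˡ-≤ 2 d≤1)
         (acyclic⇒∑degree≤ G-x (pullback-acyclic {G = G} (punchIn-injective x _ _) acyclic)) ⟩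
  2 + m * 2                              ∎
  where
  open ℕ.≤-Reasoning
  G-x = pullback (punchIn x) G

-- Irregularity of trees

-- Twice the total irregularity. The combinatorial argument stays in ℕ, and the factor `½` is
-- treated at the end.
irrSum : ∀ {n} → Graph n → ℕ
irrSum G = spread (Graph.degree G)

module _ {m} (G : Graph (suc (suc m))) (isTree : IsTree G) where
  open Adjacency G
  open IsTree isTree
  open IsConnected connected

  private
    excess : Fin (suc (suc m)) → ℕ
    excess u = pred (degree u)

    -- A walk from `u` to another vertex starts with an edge at `u`. As there are at least two
    -- vertices, `punchIn u zero` is such a target; hence the truncation in `pred` loses nothing.
    degree≡suc : ∀ u → degree u ≡ suc (excess u)
    degree≡suc u = sym (ℕ.suc-pred (degree u)
      ⦃ >-nonZero (walk⇒degree>0 (walk u (punchIn u zero)) (≢-sym (punchInᵢ≢i u zero))) ⦄)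

    -- Lowering all degrees by one keeps their differences: `∣ suc a - suc b ∣` computes to
    -- `∣ a - b ∣`.
    irrSum≡ : irrSum G ≡ spread excess
    irrSum≡ = spread-cong degree≡suc

    ∑1≡n : ∑[ _ < suc (suc m) ] 1 ≡ suc (suc m)
    ∑1≡n = trans (sum-const (suc (suc m)) 1) (ℕ.*-identityʳ (suc (suc m)))

    ∑excess≤m : sum excess ≤ℕ m
    ∑excess≤m = ℕ.+-cancelˡ-≤ (suc (suc m)) _ _ (begin
      suc (suc m) + sum excess          ≡⟨ cong (_+ sum excess) ∑1≡n ⟨
      ∑[ _ < suc (suc m) ] 1 + sum excess ≡⟨ ∑-distrib-+ (λ _ → 1) excess ⟨
      ∑[ u < suc (suc m) ] suc (excess u) ≡⟨ sum-cong-≗ degree≡suc ⟨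
      sum degree                        ≤⟨ acyclic⇒∑degree≤ G acyclic ⟩
      suc m * 2                         ≡⟨ arith m ⟩
      suc (suc m) + m                   ∎)
      where
      open ℕ.≤-Reasoning
      arith : ∀ m → suc m * 2 ≡ suc (suc m) + m
      arith = solve-∀

    bound-mono : suc m * sum excess * 2 ≤ℕ suc m * m * 2
    bound-mono = ℕ.*-monoˡ-≤ 2 (ℕ.*-monoʳ-≤ (suc m) ∑excess≤m)

  irrSum-≤ : irrSum G ≤ℕ suc m * m * 2
  irrSum-≤ = ℕ.≤-trans (ℕ.≤-reflexive irrSum≡) (ℕ.≤-trans (spread-≤ excess) bound-mono)

  -- A vertex of degree at least 2 has positive excess, so in the equality case every other excess
  -- vanishes. If there is no such vertex, any choice of center will do, here `zero`.
  irrSum-tight⇒center : irrSum G ≡ suc m * m * 2 → ∃ λ c → ∀ {u} → u ≢ c → degree u ≤ℕ 1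
  irrSum-tight⇒center tight with any? (λ u → 2 ℕ.≤? degree u)
  ... | no ¬big = zero , λ {u} _ → ℕ.≮⇒≥ (λ big → ¬big (u , big))
  ... | yes (c , big) = c , λ {u} u≢c → [ leaf u , (λ c≡0 → contradiction (leaf c c≡0) (ℕ.<⇒≱ big)) ]′
                                        (spread-≥⇒≡0 excess spread≥ u≢c)
    where
    leaf : ∀ u → excess u ≡ 0 → degree u ≤ℕ 1
    leaf u e≡0 = ℕ.≤-reflexive (trans (degree≡suc u) (cong suc e≡0))
    spread≥ : suc m * sum excess * 2 ≤ℕ spread excess
    spread≥ = ℕ.≤-trans bound-mono (ℕ.≤-reflexive (trans (sym tight) irrSum≡))

-- Stars

irrSum-iso : ∀ {m n} {G : Graph m} {H : Graph n} → Isomorphic G H → irrSum G ≡ irrSum H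
irrSum-iso {m} {n} {G} {H} (π , π-adj) = begin
  ∑[ u < m ] ∑[ v < m ] ∣ G.degree u - G.degree v ∣
    ≡⟨ spread-cong degree-π ⟩
  ∑[ u < m ] ∑[ v < m ] ∣ H.degree (π ⟨$⟩ʳ u) - H.degree (π ⟨$⟩ʳ v) ∣
    ≡⟨ sum-cong-≗ (λ u → sum-permute (λ v → ∣ H.degree (π ⟨$⟩ʳ u) - H.degree v ∣) π) ⟨
  ∑[ u < m ] ∑[ v < n ] ∣ H.degree (π ⟨$⟩ʳ u) - H.degree v ∣
    ≡⟨ sum-permute (λ u → ∑[ v < n ] ∣ H.degree u - H.degree v ∣) π ⟨
  ∑[ u < n ] ∑[ v < n ] ∣ H.degree u - H.degree v ∣
    ∎
  where
  open ≡-Reasoning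
  module G = Adjacency G
  module H = Adjacency H
  degree-π : ∀ u → G.degree u ≡ H.degree (π ⟨$⟩ʳ u)
  degree-π u = begin
    G.degree u
      ≡⟨ G.degree≡sum u ⟩
    ∑[ v < m ] G.adj u v
      ≡⟨ sum-cong-≗ (λ v → cong (if_then 1 else 0)
           (does-⇔ (π-adj u v) (u G.~? v) ((π ⟨$⟩ʳ u) H.~? (π ⟨$⟩ʳ v)))) ⟩
    ∑[ v < m ] H.adj (π ⟨$⟩ʳ u) (π ⟨$⟩ʳ v)
      ≡⟨ sum-permute (H.adj (π ⟨$⟩ʳ u)) π ⟨
    ∑[ v < n ] H.adj (π ⟨$⟩ʳ u) v
      ≡⟨ H.degree≡sum (π ⟨$⟩ʳ u) ⟨
    H.degree (π ⟨$⟩ʳ u)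
      ∎

-- Only pairs of the center and a leaf contribute: with `suc k` leaves, each such pair differs by
-- `k` and occurs in both orders.
irrSum-star : ∀ m → irrSum (K 1 m) ≡ m * (m ∸ 1) * 2
irrSum-star zero    = refl
irrSum-star (suc k) = begin
  spread degree
    ≡⟨ spread-cong degree-star ⟩
  spread star-degree
    ≡⟨⟩
  (∣ k - k ∣ + ∑[ _ < suc k ] ∣ k - 0 ∣) + ∑[ _ < suc k ] (k + ∑[ _ < suc k ] 0)
    ≡⟨ cong₂ _+_ (cong₂ _+_ (ℕ.∣n-n∣≡0 k)
                           (trans (sum-const (suc k) ∣ k - 0 ∣) (cong (suc k *_) (ℕ.∣-∣-identityʳ k))))
                 (trans (sum-const (suc k) _)
                        (cong (λ z → suc k * (k + z)) (sum-zero {suc k} λ _ → refl))) ⟩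
  (0 + suc k * k) + suc k * (k + 0)
    ≡⟨ arith k ⟩
  suc k * k * 2
    ∎
  where
  open ≡-Reasoning
  open Adjacency (K 1 (suc k))
  star-degree : Fin (suc (suc k)) → ℕ
  star-degree zero    = suc k
  star-degree (suc _) = 1
  degree-star : degree ≗ star-degree
  degree-star zero    = trans (degree≡sum zero) (trans (sum-const (suc k) 1) (ℕ.*-identityʳ (suc k)))
  degree-star (suc u) = trans (degree≡sum (suc u)) (cong suc (sum-zero {suc k} λ _ → refl))
  arith : ∀ k → (0 + suc k * k) + suc k * (k + 0) ≡ suc k * k * 2
  arith = solve-∀

insert-maps : ∀ {m n} i j (π : Perm.Permutation m n) → Perm.insert i j π ⟨$⟩ʳ i ≡ j
insert-maps i j π with i ≟ i
... | yes _   = refl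
... | no  i≢i = contradiction refl i≢i

module _ {m} (G : Graph (suc m)) (connected : IsConnected G) (c : Fin (suc m))
         (leaf : ∀ {u} → u ≢ c → Graph.degree G u ≤ℕ 1) where
  open Adjacency G
  open IsConnected connected

  private
    -- If the first step led to some `w ≢ c`, then by induction `w ~ c`, and the leaf `w` would have
    -- both `u` and `c` as neighbours.
    walk⇒~center : ∀ {u} → Star _~_ u c → u ≢ c → u ~ c
    walk⇒~center ε u≢c = contradiction refl u≢c
    walk⇒~center (_◅_ {j = w} u~w w⋯c) u≢c with w ≟ c
    ... | yes refl = u~w
    ... | no w≢c = contradiction
      (degree≤1⇒unique-neighbour (leaf w≢c) (~-sym u~w) (walk⇒~center w⋯c w≢c)) u≢c

    ~center : ∀ {u} → u ≢ c → u ~ c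
    ~center {u} = walk⇒~center (walk u c)

    leaves-≁ : ∀ {u v} → u ≢ c → v ≢ c → ¬ (u ~ v)
    leaves-≁ u≢c v≢c u~v = v≢c (degree≤1⇒unique-neighbour (leaf u≢c) u~v (~center u≢c))

    -- Sends `c` to `zero`, the one-vertex part of `K 1 m`, and the remaining vertices to the
    -- successors in order.
    π = Perm.insert c zero Perm.id

    -- Couples the case distinction with the value of `π`; rewriting by that value makes adjacency
    -- in `K 1 m` compute to a disequality of Boolean constants.
    data Position (u : Fin (suc m)) : Set where
      center : u ≡ c → π ⟨$⟩ʳ u ≡ zero → Position u
      outer  : u ≢ c → ∀ k → π ⟨$⟩ʳ u ≡ suc k → Position u

    position : ∀ u → Position u
    position u with c ≟ u
    ... | yes refl = center refl (insert-maps c zero Perm.id)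
    ... | no  c≢u  = outer (≢-sym c≢u) (punchOut c≢u)
      (trans (cong (π ⟨$⟩ʳ_) (sym (punchIn-punchOut c≢u)))
             (Perm.insert-punchIn c zero Perm.id (punchOut c≢u)))

  center⇒star : IsStar G
  center⇒star = π , adjacency
    where
    adjacency : ∀ u v → (u ~ v) ⇔ Graph._~_ (K 1 m) (π ⟨$⟩ʳ u) (π ⟨$⟩ʳ v)
    adjacency u v with position u | position v
    ... | center refl πu | center refl πv =
      mk⇔ (λ u~u → contradiction u~u (~-irrefl refl)) λ ≢ → contradiction refl ≢
    ... | center refl πu | outer v≢c _ πv rewrite πu | πv = mk⇔ (λ _ ()) (λ _ → ~-sym (~center v≢c))
    ... | outer u≢c _ πu | center refl πv rewrite πu | πv = mk⇔ (λ _ ()) (λ _ → ~center u≢c)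
    ... | outer u≢c _ πu | outer v≢c _ πv rewrite πu | πv =
      mk⇔ (λ u~v → contradiction u~v (leaves-≁ u≢c v≢c)) λ ≢ → contradiction refl ≢

-- Halving in the rationals

private
  -- The form to which `½` times `s / 1` computes on unnormalised fractions; the last argument of
  -- `mkℚᵘ` is the denominator less one.
  half : ℕ → ℚᵘ.ℚᵘ
  half s = mkℚᵘ (+ 1 ℤ.* + s) 1

  toℚᵘ-half : ∀ s → toℚᵘ (½ ℚ.* (+ s / 1)) ℚᵘ.≃ half s
  toℚᵘ-half s = ℚᵘ.≃-trans (ℚ.toℚᵘ-homo-* ½ (+ s / 1))
                  (ℚᵘ.*-congˡ {toℚᵘ ½} (ℚ.toℚᵘ-fromℚᵘ (mkℚᵘ (+ s) 0)))

  toℚᵘ-integer : ∀ z → toℚᵘ (z / 1) ℚᵘ.≃ mkℚᵘ z 0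
  toℚᵘ-integer z = ℚ.toℚᵘ-fromℚᵘ (mkℚᵘ z 0)

  1*s*1≡s : ∀ s → + 1 ℤ.* + s ℤ.* + 1 ≡ + s
  1*s*1≡s s = trans (ℤ.*-identityʳ _) (ℤ.*-identityˡ (+ s))

-- On unnormalised fractions the order is cross-multiplication, which turns the claim into
-- `s ≤ℕ b * 2`.
half-≤ : ∀ s b → s ≤ℕ b * 2 → ½ ℚ.* (+ s / 1) ≤ + b / 1
half-≤ s b s≤2b = ℚ.toℚᵘ-cancel-≤ (ℚᵘ.≤-respˡ-≃ (ℚᵘ.≃-sym (toℚᵘ-half s))
  (ℚᵘ.≤-respʳ-≃ (ℚᵘ.≃-sym (toℚᵘ-integer (+ b)))
    (*≤* (subst₂ ℤ._≤_ (sym (1*s*1≡s s)) (ℤ.pos-* b 2) (ℤ.+≤+ s≤2b)))))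

half-≡ : ∀ s b → s ≡ b * 2 ⇔ ½ ℚ.* (+ s / 1) ≡ + b / 1
half-≡ s b = mk⇔
  (λ eq → ℚ.toℚᵘ-injective (ℚᵘ.≃-trans (toℚᵘ-half s) (ℚᵘ.≃-trans
    (*≡* (trans (1*s*1≡s s) (trans (cong +_ eq) (ℤ.pos-* b 2))))
    (ℚᵘ.≃-sym (toℚᵘ-integer (+ b))))))
  (λ eq → ℤ.+-injective (trans (sym (1*s*1≡s s)) (trans
    (ℚᵘ.drop-*≡* (ℚᵘ.≃-trans (ℚᵘ.≃-sym (toℚᵘ-half s))
      (ℚᵘ.≃-trans (ℚᵘ.≃-reflexive (cong toℚᵘ eq)) (toℚᵘ-integer (+ b)))))
    (sym (ℤ.pos-* b 2)))))

-- Trees of every order: the bound and the equality case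

tree-irrSum-≤ : ∀ {m} (G : Graph (suc m)) → IsTree G → irrSum G ≤ℕ m * (m ∸ 1) * 2
-- With one vertex, the bound of `spread-≤` and the claimed bound both have a factor 0 and compute
-- to 0.
tree-irrSum-≤ {zero}  G _    = spread-≤ (Graph.degree G)
tree-irrSum-≤ {suc m} G tree = irrSum-≤ G tree

tree-irrSum-tight⇒star : ∀ {m} (G : Graph (suc m)) → IsTree G →
                         irrSum G ≡ m * (m ∸ 1) * 2 → IsStar G
tree-irrSum-tight⇒star {zero}  G tree _ =
  center⇒star G (IsTree.connected tree) zero λ { {zero} 0≢0 → contradiction refl 0≢0 }
tree-irrSum-tight⇒star {suc m} G tree tight with irrSum-tight⇒center G tree tight
... | c , leaf = center⇒star G (IsTree.connected tree) c leaf

-- The integer factor n - 2 is negative at n = 1, where `m ∸ 1` truncates; the other factor is then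
-- 0 on both sides.
bound-in-ℕ : ∀ m → (+ suc m ℤ.- + 1) ℤ.* (+ suc m ℤ.- + 2) ≡ + (m * (m ∸ 1))
bound-in-ℕ zero    = refl
bound-in-ℕ (suc k) = sym (ℤ.pos-* (suc k) k)

proposition2p2 : ∀ (n : ℕ) (G : Graph n) → IsTree G →
    (irrₜ G ≤ ((+ n ℤ.- + 1) ℤ.* (+ n ℤ.- + 2)) / 1) ×
    ((irrₜ G ≡ ((+ n ℤ.- + 1) ℤ.* (+ n ℤ.- + 2)) / 1) ⇔ IsStar G)
proposition2p2 zero    G tree =
  contradiction refl (≢-nonZero⁻¹ 0 ⦃ IsConnected.nonEmpty (IsTree.connected tree) ⦄)
-- After the rewrite the bound is a natural number over 1, and `irrₜ G` unfolds to `½` times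
-- `irrSum G`, as the halving lemmas expect.
proposition2p2 (suc m) G tree rewrite bound-in-ℕ m =
  half-≤ (irrSum G) bound (tree-irrSum-≤ G tree) ,
  mk⇔ (λ eq → tree-irrSum-tight⇒star G tree (Equivalence.from twice eq))
      (λ star → Equivalence.to twice (trans (irrSum-iso {G = G} {K 1 m} star) (irrSum-star m)))
  where
  bound = m * (m ∸ 1)
  twice = half-≡ (irrSum G) bound
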